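{- Let $\alpha=(\alpha_1,\dots,\alpha_s)\in\mathbb{Z}^s$ with $\alpha_i\cdot\alpha_{i+1}<0$ for all $1\le i\le s-1$ and $\alpha_1\ge 0$, and let $T$ be a tournament of order $n=\sum_{i=1}^s|\alpha_i|+1$. Then $$f_T(\alpha)=f_T(-\alpha),$$ where $-\alpha=(-\alpha_1,\dots,-\alpha_s)$ and $f_T(\gamma)$ denotes the number of oriented (here necessarily Hamiltonian) paths of $T$ of type $P(\gamma)$.
   Context: A tournament is an orientation of a finite complete graph. An oriented path $P=v_1v_2\dots v_r$ in a tournament $T$ consists of distinct vertices $v_1,\dots,v_r$ together with the arcs of $T$ joining consecutive vertices; $v_1\dots v_r$ and $v_r\dots v_1$ denote the same path, and two paths are equal iff they have the same set of arcs (a one-vertex path being determined by its vertex). A block is a maximal directed subpath. For a tuple $\alpha=(\alpha_1,\dots,\alpha_s)$ of nonzero integers with alternating signs, $v_1\dots v_r$ has type $P(\alpha)$ with respect to this enumeration if $r=\sum|\alpha_i|+1$ and, traversing from $v_1$ to $v_r$, one meets successively exactly $s$ blocks $I_1,\dots,I_s$, with $I_i$ of length $|\alpha_i|$, and $I_i$ directed in the sense of the traversal iff $\alpha_i>0$. A one-vertex path has type $P(0)$. A path is of type $P(\alpha)$ if it has this type with respect to one of its two enumerations (so a path of type $P(\alpha_1,\dots,\alpha_s)$ is also of type $P(-\alpha_s,\dots,-\alpha_1)$). $f_T(\alpha)$ is the number of paths in $T$ of type $P(\alpha)$, each path counted once. -}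

module Defs where

open import Data.Fin.Base using (Fin; zero; suc; inject₁; fromℕ; toℕ) renaming (_≤_ to _≤ᶠ_; _<_ to _<ᶠ_)
open import Data.Fin.Properties using (all?; any?) renaming (_≟_ to _≟ᶠ_; _≤?_ to _≤ᶠ?_; _<?_ to _<ᶠ?_)
open import Data.Integer.Base as ℤ using (ℤ; 0ℤ; ∣_∣)
import Data.Integer.Properties as ℤₚ
open import Data.List.Base as List using (List; allFin; cartesianProductWith; filter; deduplicate; length)
open import Data.List.Properties using (≡-dec)
open import Data.Nat.Base using (ℕ; zero; suc; _+_)
import Data.Nat.Properties as ℕₚ
open import Data.Product.Base using (_×_; ∃; _,_)
open import Data.Sum.Base using (_⊎_)
open import Data.Vec.Base as Vec using (Vec; []; _∷_; lookup; reverse; toList)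
open import Data.Vec.Relation.Unary.AllPairs using (allPairs?)
open import Data.Vec.Relation.Unary.Unique.Propositional using (Unique)
open import Function.Bundles using (_⇔_; mk⇔; module Equivalence)
open import Level using (0ℓ)
open import Relation.Binary.Consequences using (tri⇒dec<)
open import Relation.Binary.Core using (Rel)
open import Relation.Binary.Definitions using (Decidable; Trichotomous)
open import Relation.Binary.PropositionalEquality using (_≡_)
open import Relation.Nullary.Decidable using (Dec; map′; ¬?; _×-dec_; _⊎-dec_; _→-dec_)

-- Trichotomy says that there are no loops and that exactly one of u ⟶ v and
-- v ⟶ u holds for distinct u and v.
record Tournament (n : ℕ) : Set₁ where
  infix 4 _⟶_ _⟶?_
  field
    _⟶_  : Rel (Fin n) 0ℓ
    trichotomous : Trichotomous _≡_ _⟶_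

  _⟶?_ : Decidable _⟶_
  _⟶?_ = tri⇒dec< trichotomous

size : ∀ {s} → Vec ℤ s → ℕ
size γ = Vec.sum (Vec.map ∣_∣ γ)

negate : ∀ {s} → Vec ℤ s → Vec ℤ s
negate = Vec.map (ℤ.-_)

_⇔-dec_ : ∀ {A B : Set} → Dec A → Dec B → Dec (A ⇔ B)
a? ⇔-dec b? = map′ (λ (f , g) → mk⇔ f g) (λ e → Equivalence.to e , Equivalence.from e)
                   ((a? →-dec b?) ×-dec (b? →-dec a?))

allVecs : ∀ n r → List (Vec (Fin n) r)
allVecs n zero    = List.[ [] ]
allVecs n (suc r) = cartesianProductWith _∷_ (allFin n) (allVecs n r)

module _ {n : ℕ} (T : Tournament n) where
  open Tournament T

  -- Throughout, p enumerates the vertices v₀ v₁ … v_k of a path, and positions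
  -- along it are elements of Fin (suc k).  The i-th step joins the positions
  -- inject₁ i and suc i.
  module _ {k : ℕ} (p : Vec (Fin n) (suc k)) where

    Forward : Rel (Fin (suc k)) 0ℓ
    Forward a b = ∀ (i : Fin k) → a ≤ᶠ inject₁ i → suc i ≤ᶠ b →
                  lookup p (inject₁ i) ⟶ lookup p (suc i)

    Backward : Rel (Fin (suc k)) 0ℓ
    Backward a b = ∀ (i : Fin k) → a ≤ᶠ inject₁ i → suc i ≤ᶠ b →
                   lookup p (suc i) ⟶ lookup p (inject₁ i)

    Directed : Rel (Fin (suc k)) 0ℓ
    Directed a b = Forward a b ⊎ Backward a b

    Block : Rel (Fin (suc k)) 0ℓ
    Block a b = a <ᶠ b × Directed a b ×
                (∀ a′ b′ → a′ ≤ᶠ a → b ≤ᶠ b′ → Directed a′ b′ → a′ ≡ a × b′ ≡ b)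

    -- From position a to the end of the path one meets successively exactly the
    -- blocks prescribed by γ.
    Blocks : ∀ {s} → Fin (suc k) → Vec ℤ s → Set
    Blocks a []      = a ≡ fromℕ k
    Blocks a (c ∷ γ) = ∃ λ b → Block a b
                             × toℕ b ≡ toℕ a + ∣ c ∣
                             × (Forward a b ⇔ 0ℤ ℤ.< c)
                             × Blocks b γ

    forward? : Decidable Forward
    forward? a b = all? λ i → (a ≤ᶠ? inject₁ i) →-dec ((suc i ≤ᶠ? b) →-dec
                     (lookup p (inject₁ i) ⟶? lookup p (suc i)))

    backward? : Decidable Backward
    backward? a b = all? λ i → (a ≤ᶠ? inject₁ i) →-dec ((suc i ≤ᶠ? b) →-dec
                      (lookup p (suc i) ⟶? lookup p (inject₁ i)))

    directed? : Decidable Directed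
    directed? a b = forward? a b ⊎-dec backward? a b

    block? : Decidable Block
    block? a b = (a <ᶠ? b) ×-dec (directed? a b ×-dec
      (all? λ a′ → all? λ b′ → (a′ ≤ᶠ? a) →-dec ((b ≤ᶠ? b′) →-dec
        (directed? a′ b′ →-dec ((a′ ≟ᶠ a) ×-dec (b′ ≟ᶠ b))))))

    blocks? : ∀ {s} a (γ : Vec ℤ s) → Dec (Blocks a γ)
    blocks? a []      = a ≟ᶠ fromℕ k
    blocks? a (c ∷ γ) = any? λ b → block? a b
      ×-dec ((toℕ b ℕₚ.≟ toℕ a + ∣ c ∣)
      ×-dec ((forward? a b ⇔-dec (0ℤ ℤₚ.<? c))
      ×-dec blocks? b γ))

    Arc : Rel (Fin n) 0ℓ
    Arc u v = u ⟶ v × ∃ λ (i : Fin k) →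
      (lookup p (inject₁ i) ≡ u × lookup p (suc i) ≡ v) ⊎
      (lookup p (inject₁ i) ≡ v × lookup p (suc i) ≡ u)

    arc? : Decidable Arc
    arc? u v = (u ⟶? v) ×-dec any? λ i →
      ((lookup p (inject₁ i) ≟ᶠ u) ×-dec (lookup p (suc i) ≟ᶠ v)) ⊎-dec
      ((lookup p (inject₁ i) ≟ᶠ v) ×-dec (lookup p (suc i) ≟ᶠ u))

  -- Two enumerations give the same path iff they have the same arcs, except that
  -- a one-vertex path has no arcs and is determined by its vertex.
  SamePath : ∀ {k} → Rel (Vec (Fin n) (suc k)) 0ℓ
  SamePath {zero}  p q = lookup p zero ≡ lookup q zero
  SamePath {suc k} p q = ∀ u v → Arc p u v ⇔ Arc q u v

  samePath? : ∀ {k} → Decidable (SamePath {k})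
  samePath? {zero}  p q = lookup p zero ≟ᶠ lookup q zero
  samePath? {suc k} p q = all? λ u → all? λ v → arc? p u v ⇔-dec arc? q u v

  module _ {s : ℕ} (γ : Vec ℤ s) where

    -- The left summand is the convention that a one-vertex path has type P(0).
    TypeAlong : Vec (Fin n) (suc (size γ)) → Set
    TypeAlong p = toList γ ≡ List.[ 0ℤ ] ⊎ Blocks p zero γ

    PathOfType : Vec (Fin n) (suc (size γ)) → Set
    PathOfType p = Unique p × (TypeAlong p ⊎ TypeAlong (reverse p))

    typeAlong? : ∀ p → Dec (TypeAlong p)
    typeAlong? p = ≡-dec ℤₚ._≟_ (toList γ) List.[ 0ℤ ] ⊎-dec blocks? p zero γ

    pathOfType? : ∀ p → Dec (PathOfType p)
    pathOfType? p = allPairs? (λ u v → ¬? (u ≟ᶠ v)) p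
                    ×-dec (typeAlong? p ⊎-dec typeAlong? (reverse p))

    -- Deduplication keeps one enumeration per path.
    f : ℕ
    f = length (deduplicate samePath? (filter pathOfType? (allVecs n (suc (size γ)))))

-- Encode an enumeration of a path by the word of directions of its steps.  For a
-- set S of steps, reversing every maximal run of steps in S matches the
-- enumerations that go forward on S with those that go backward on S.  By
-- inclusion–exclusion every word is therefore read along as many enumerations as
-- its complement.  A path with an arc has exactly two enumerations, which read
-- converse words, and complementation commutes with taking converses; so the
-- count of enumerations, twice f, is the same for α and −α.

module Submission where

open import Defs
open import Data.Nat using (ℕ; suc)
open import Data.Integer using (ℤ; 0ℤ; _*_; _≤_; _<_)
open import Data.Fin using (Fin; inject₁; suc)
open import Data.Vec using (Vec; head; lookup)
open import Relation.Binary.PropositionalEquality using (_≡_)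

open import Data.Bool.Base using (Bool; true; false; not; _∧_; T)
open import Data.Bool.Properties using (not-involutive; not-¬; T?) renaming (_≟_ to _≟ᵇ_)
open import Data.Empty using (⊥-elim)
open import Data.Fin.Base using (zero; fromℕ; fromℕ<; toℕ; _↑ˡ_; _↑ʳ_; splitAt; join; opposite)
open import Data.Fin.Properties
  using (toℕ-injective; toℕ-inject₁; toℕ-fromℕ; toℕ-fromℕ<; toℕ<n; toℕ-↑ˡ; toℕ-↑ʳ;
         opposite-involutive; splitAt-↑ˡ; splitAt-↑ʳ) renaming (_≟_ to _≟ᶠ_)
import Data.Integer.Base as ℤ
import Data.Integer.Properties as ℤₚ
open import Data.List.Base as List using (List; []; _∷_; length; filter; filterᵇ; deduplicate)
open import Data.List.Membership.Propositional using (_∈_; find; lose)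
open import Data.List.Membership.Propositional.Properties
  using (∈-map⁺; ∈-map⁻; ∈-++⁺ˡ; ∈-++⁺ʳ; ∈-++⁻; ∈-filter⁺; ∈-filter⁻; ∈-deduplicate⁻;
         ∈-allFin; ∈-cartesianProductWith⁺)
open import Data.List.Membership.Propositional.Properties.WithK using (unique∧set⇒bag)
open import Data.List.Properties using (length-map; length-++; filter-≐; ∷-injectiveˡ)
open import Data.List.Relation.Binary.BagAndSetEquality using (∼bag⇒↭)
open import Data.List.Relation.Binary.Permutation.Propositional
  using (_↭_; ↭-refl; ↭-prep; ↭-sym; ↭-trans)
open import Data.List.Relation.Binary.Permutation.Propositional.Properties
  using (↭-length; shift; ++⁺; map⁺; filter-↭)
import Data.List.Relation.Unary.All as All
open import Data.List.Relation.Unary.AllPairs using (AllPairs; []; _∷_)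
open import Data.List.Relation.Unary.Any using (here; there)
import Data.List.Relation.Unary.Any.Properties as Any
open import Data.List.Relation.Unary.Unique.DecSetoid.Properties using (deduplicate-!)
open import Data.List.Relation.Unary.Unique.Propositional using () renaming (Unique to Uniqueˡ)
import Data.List.Relation.Unary.Unique.Propositional.Properties as Uniqueˡ
import Data.Nat.Base as ℕ
import Data.Nat.Properties as ℕₚ
open import Data.Product.Base using (Σ; ∃; _×_; _,_; proj₁; proj₂)
open import Data.Sum.Base as Sum using (_⊎_; inj₁; inj₂; [_,_]′)
open import Data.Unit.Base using (⊤; tt)
open import Data.Vec.Base as Vec using ([]; _∷_; _∷ʳ_; _++_; replicate; reverse; tabulate)
open import Data.Vec.Properties
  using (reverse-∷; reverse-involutive; reverse-reverse; map-reverse; map-++; map-replicate;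
         lookup∘tabulate; tabulate∘lookup; tabulate-cong; lookup-map; lookup-replicate;
         lookup-++ˡ; lookup-++ʳ; ∷-injective) renaming (≡-dec to ≡-decᵛ)
open import Data.Vec.Relation.Unary.AllPairs as AllPairs using (allPairs?)
open import Data.Vec.Relation.Unary.Unique.Propositional using (Unique)
open import Data.Vec.Relation.Unary.Unique.Propositional.Properties using (lookup-injective; tabulate⁺)
open import Function.Base using (_∘_; id)
open import Function.Bundles using (mk⇔; module Equivalence)
open import Level using (0ℓ)
open import Relation.Binary.Core using (Rel)
open import Relation.Binary.Definitions using (tri<; tri≈; tri>)
open import Relation.Binary.PropositionalEquality
  using (_≢_; refl; sym; trans; cong; cong₂; subst; module ≡-Reasoning)
open import Relation.Binary.Structures using (IsDecEquivalence; IsEquivalence)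
open import Relation.Nullary using (¬_; Dec; yes; no; does; contradiction)
open import Relation.Nullary.Decidable using (_⊎-dec_; ¬?; dec-true; dec-false)
open import Relation.Unary using (Decidable)

-- Reversing the runs of `S` exchanges the end vertices of each run, so the steps between runs are
-- replaced by steps whose directions are not controlled; the map need not complement a whole word.
-- On `S` itself it flips every step, whatever the tournament does elsewhere. Hence the comparison
-- is possible only for "at least on `S`", and exact words have to be recovered from all `S`
-- together. The words read by the enumerations form a list taken up to `_↭_`; the recovery then
-- needs no alternating sums, since it removes one letter at a time and subtracts.

-- Counting with duplicate-free lists

bijection⇒length : {A B : Set} {xs : List A} {ys : List B} → Uniqueˡ xs → Uniqueˡ ys →
                   (f : A → B) (g : B → A) →
                   (∀ {x} → x ∈ xs → f x ∈ ys) → (∀ {y} → y ∈ ys → g y ∈ xs) →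
                   (∀ x → g (f x) ≡ x) → (∀ y → f (g y) ≡ y) → length xs ≡ length ys
bijection⇒length {xs = xs} {ys} xs! ys! f g f∈ g∈ gf fg =
  trans (sym (length-map f xs)) (↭-length (∼bag⇒↭ (unique∧set⇒bag fxs! ys! (mk⇔ to from))))
  where
  fxs! : Uniqueˡ (List.map f xs)
  fxs! = Uniqueˡ.map⁺ (λ {x} {y} eq → trans (sym (gf x)) (trans (cong g eq) (gf y))) xs!

  to : ∀ {y} → y ∈ List.map f xs → y ∈ ys
  to y∈ with x , x∈ , refl ← ∈-map⁻ f y∈ = f∈ x∈

  from : ∀ {y} → y ∈ ys → y ∈ List.map f xs
  from {y} y∈ = subst (_∈ List.map f xs) (fg y) (∈-map⁺ f (g∈ y∈))

-- `AllPairs` excludes related pairs in list order only; symmetry of `R` covers the other order.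
pairwise-related⇒≡ : {A : Set} {R : Rel A 0ℓ} {xs : List A} → (∀ {x y} → R x y → R y x) →
                     AllPairs (λ x y → ¬ R x y) xs → ∀ {x y} → x ∈ xs → y ∈ xs → R x y → x ≡ y
pairwise-related⇒≡ R-sym (_ ∷ _)   (here refl) (here refl) _   = refl
pairwise-related⇒≡ R-sym (¬R ∷ _)  (here refl) (there y∈)  Rxy = contradiction Rxy (All.lookup ¬R y∈)
pairwise-related⇒≡ R-sym (¬R ∷ _)  (there x∈)  (here refl) Rxy = contradiction (R-sym Rxy) (All.lookup ¬R x∈)
pairwise-related⇒≡ R-sym (_ ∷ xs!) (there x∈)  (there y∈)  Rxy = pairwise-related⇒≡ R-sym xs! x∈ y∈ Rxy

-- Each class within `xs` is a pair of distinct elements `x`, `ρ x`. Deduplication keeps one of the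
-- two and `ρ` recovers the other, so `xs` is a rearrangement of `D` followed by its image under
-- `ρ`.
length-deduplicate-pairs :
  {A : Set} {_≈_ : Rel A 0ℓ} (dec : IsDecEquivalence _≈_) (ρ : A → A) {xs : List A} → Uniqueˡ xs →
  (∀ x → ρ (ρ x) ≡ x) → (∀ {x} → x ∈ xs → ρ x ∈ xs) → (∀ {x} → x ∈ xs → ρ x ≢ x) →
  (∀ x → x ≈ ρ x) → (∀ {x y} → x ∈ xs → y ∈ xs → x ≈ y → y ≡ x ⊎ y ≡ ρ x) →
  let D = deduplicate (IsDecEquivalence._≟_ dec) xs in length xs ≡ length D ℕ.+ length D
length-deduplicate-pairs {A} {_≈_} dec ρ {xs} xs! ρρ ρ∈ ρ≢ ≈ρ classes = begin
  length xs                        ≡⟨ ↭-length (∼bag⇒↭ (unique∧set⇒bag xs! DρD! (mk⇔ to from))) ⟩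
  length (D List.++ List.map ρ D)  ≡⟨ length-++ D ⟩
  length D ℕ.+ length (List.map ρ D) ≡⟨ cong (length D ℕ.+_) (length-map ρ D) ⟩
  length D ℕ.+ length D            ∎
  where
  open ≡-Reasoning
  open IsDecEquivalence dec using (_≟_) renaming (refl to ≈-refl; sym to ≈-sym; trans to ≈-trans)

  D : List A
  D = deduplicate _≟_ xs

  D⊆ : ∀ {x} → x ∈ D → x ∈ xs
  D⊆ = ∈-deduplicate⁻ _≟_ xs

  D! : AllPairs (λ x y → ¬ (x ≈ y)) D
  D! = deduplicate-! (record { isDecEquivalence = dec }) xs

  ρ-injective : ∀ {x y} → ρ x ≡ ρ y → x ≡ y
  ρ-injective {x} {y} eq = trans (sym (ρρ x)) (trans (cong ρ eq) (ρρ y))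

  D-unique : ∀ {ys} → AllPairs (λ x y → ¬ (x ≈ y)) ys → Uniqueˡ ys
  D-unique []        = []
  D-unique (¬≈ ∷ ys) = All.map (λ { ¬x≈y refl → ¬x≈y ≈-refl }) ¬≈ ∷ D-unique ys

  DρD! : Uniqueˡ (D List.++ List.map ρ D)
  DρD! = Uniqueˡ.++⁺ (D-unique D!) (Uniqueˡ.map⁺ ρ-injective (D-unique D!)) disjoint
    where
    disjoint : ∀ {v} → ¬ (v ∈ D × v ∈ List.map ρ D)
    disjoint (v∈ , v∈ρ) with y , y∈ , refl ← ∈-map⁻ ρ v∈ρ =
      -- Both `y` and `ρ y` would be representatives of the same class, hence equal.
      ρ≢ (D⊆ y∈) (sym (pairwise-related⇒≡ ≈-sym D! y∈ v∈ (≈ρ y)))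

  to : ∀ {x} → x ∈ xs → x ∈ D List.++ List.map ρ D
  to {x} x∈
    -- `x` itself may have been dropped, but some member of its class survives.
    with y , y∈ , y≈x ← find (Any.deduplicate⁺ _≟_ {P = _≈ x} (λ z≈y y≈x → ≈-trans z≈y y≈x) (lose x∈ ≈-refl))
    with classes (D⊆ y∈) x∈ y≈x
  ... | inj₁ refl = ∈-++⁺ˡ y∈
  ... | inj₂ refl = ∈-++⁺ʳ D (∈-map⁺ ρ y∈)

  from : ∀ {x} → x ∈ D List.++ List.map ρ D → x ∈ xs
  from x∈ with ∈-++⁻ D x∈
  ... | inj₁ x∈D = D⊆ x∈D
  ... | inj₂ x∈ρD with y , y∈ , refl ← ∈-map⁻ ρ x∈ρD = ρ∈ (D⊆ y∈)

∈-allVecs : ∀ {n r} (p : Vec (Fin n) r) → p ∈ allVecs n r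
∈-allVecs []      = here refl
∈-allVecs (x ∷ p) = ∈-cartesianProductWith⁺ _∷_ (∈-allFin x) (∈-allVecs p)

allVecs! : ∀ n r → Uniqueˡ (allVecs n r)
allVecs! n ℕ.zero    = All.[] ∷ []
allVecs! n (ℕ.suc r) = Uniqueˡ.cartesianProductWith⁺ _∷_ ∷-injective (Uniqueˡ.allFin⁺ n) (allVecs! n r)

-- Words determined by superset counts

infix 4 _⊆ᵇ_

-- The Boolean form computes letter by letter, as the induction on word length requires; the
-- pointwise form `_⊆_` is the one that can be followed when positions are permuted.
_⊆ᵇ_ : ∀ {k} → Vec Bool k → Vec Bool k → Bool
[]          ⊆ᵇ []      = true
(true ∷ S)  ⊆ᵇ (b ∷ v) = b ∧ (S ⊆ᵇ v)
(false ∷ S) ⊆ᵇ (b ∷ v) = S ⊆ᵇ v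

infix 4 _⊆_

_⊆_ : ∀ {k} → Vec Bool k → Vec Bool k → Set
S ⊆ v = ∀ i → lookup S i ≡ true → lookup v i ≡ true

⊆ᵇ⇒⊆ : ∀ {k} (S v : Vec Bool k) → T (S ⊆ᵇ v) → S ⊆ v
⊆ᵇ⇒⊆ (true ∷ S)  (true ∷ v) t zero    _  = refl
⊆ᵇ⇒⊆ (true ∷ S)  (true ∷ v) t (suc i) Sᵢ = ⊆ᵇ⇒⊆ S v t i Sᵢ
⊆ᵇ⇒⊆ (false ∷ S) (b ∷ v)    t (suc i) Sᵢ = ⊆ᵇ⇒⊆ S v t i Sᵢ

⊆⇒⊆ᵇ : ∀ {k} (S v : Vec Bool k) → S ⊆ v → T (S ⊆ᵇ v)
⊆⇒⊆ᵇ []          []          S⊆v = tt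
⊆⇒⊆ᵇ (true ∷ S)  (true ∷ v)  S⊆v = ⊆⇒⊆ᵇ S v (S⊆v ∘ suc)
⊆⇒⊆ᵇ (true ∷ S)  (false ∷ v) S⊆v with () ← S⊆v zero refl
⊆⇒⊆ᵇ (false ∷ S) (b ∷ v)     S⊆v = ⊆⇒⊆ᵇ S v (S⊆v ∘ suc)

supersets : ∀ {k} → Vec Bool k → List (Vec Bool k) → ℕ
supersets S X = length (filterᵇ (S ⊆ᵇ_) X)

trueTails falseTails : ∀ {k} → List (Vec Bool (suc k)) → List (Vec Bool k)
trueTails []                = []
trueTails ((true ∷ v) ∷ X)  = v ∷ trueTails X
trueTails ((false ∷ v) ∷ X) = trueTails X
falseTails []                = []
falseTails ((true ∷ v) ∷ X)  = falseTails X
falseTails ((false ∷ v) ∷ X) = v ∷ falseTails X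

tails-↭ : ∀ {k} (X : List (Vec Bool (suc k))) →
          X ↭ List.map (true ∷_) (trueTails X) List.++ List.map (false ∷_) (falseTails X)
tails-↭ []                = ↭-refl
tails-↭ ((true ∷ v) ∷ X)  = ↭-prep (true ∷ v) (tails-↭ X)
tails-↭ ((false ∷ v) ∷ X) =
  ↭-trans (↭-prep (false ∷ v) (tails-↭ X)) (↭-sym (shift (false ∷ v) (List.map (true ∷_) (trueTails X)) _))

supersets-true : ∀ {k} (S : Vec Bool k) X → supersets (true ∷ S) X ≡ supersets S (trueTails X)
supersets-true S []                = refl
supersets-true S ((true ∷ v) ∷ X) with S ⊆ᵇ v
... | true  = cong suc (supersets-true S X)
... | false = supersets-true S X
supersets-true S ((false ∷ v) ∷ X) = supersets-true S X

supersets-false : ∀ {k} (S : Vec Bool k) X →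
                  supersets (false ∷ S) X ≡ supersets S (trueTails X) ℕ.+ supersets S (falseTails X)
supersets-false S []                = refl
supersets-false S ((true ∷ v) ∷ X) with S ⊆ᵇ v
... | true  = cong suc (supersets-false S X)
... | false = supersets-false S X
supersets-false S ((false ∷ v) ∷ X) with S ⊆ᵇ v
... | true  = trans (cong suc (supersets-false S X)) (sym (ℕₚ.+-suc _ _))
... | false = supersets-false S X

-- Inclusion–exclusion: the superset counts determine the multiset.
supersets⇒↭ : ∀ {k} (X Y : List (Vec Bool k)) → (∀ S → supersets S X ≡ supersets S Y) → X ↭ Y
supersets⇒↭ {ℕ.zero} []       []       _  = ↭-refl
supersets⇒↭ {ℕ.zero} []       ([] ∷ Y) eq with () ← eq []
supersets⇒↭ {ℕ.zero} ([] ∷ X) []       eq with () ← eq []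
supersets⇒↭ {ℕ.zero} ([] ∷ X) ([] ∷ Y) eq =
  ↭-prep [] (supersets⇒↭ X Y λ { [] → ℕₚ.suc-injective (eq []) })
supersets⇒↭ {suc k} X Y eq =
  ↭-trans (tails-↭ X) (↭-trans (++⁺ (map⁺ _ trues) (map⁺ _ falses)) (↭-sym (tails-↭ Y)))
  where
  eq-true : ∀ S → supersets S (trueTails X) ≡ supersets S (trueTails Y)
  eq-true S = trans (sym (supersets-true S X)) (trans (eq (true ∷ S)) (supersets-true S Y))

  eq-sum : ∀ S → supersets S (trueTails X) ℕ.+ supersets S (falseTails X) ≡
                 supersets S (trueTails X) ℕ.+ supersets S (falseTails Y)
  eq-sum S = trans (sym (supersets-false S X)) (trans (eq (false ∷ S))
               (trans (supersets-false S Y) (cong (ℕ._+ _) (sym (eq-true S)))))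

  trues : trueTails X ↭ trueTails Y
  trues = supersets⇒↭ _ _ eq-true

  -- The sets `false ∷ S` leave the first letter free and count both kinds of tails; cancelling the
  -- true tails, already matched, isolates the false ones.
  falses : falseTails X ↭ falseTails Y
  falses = supersets⇒↭ _ _ λ S → ℕₚ.+-cancelˡ-≡ (supersets S (trueTails X)) _ _ (eq-sum S)

-- Runs of a set of steps and their reversal

-- A view that refines the index itself to `i ↑ˡ n` or `m ↑ʳ j`, the form expected by the lookup
-- lemmas for `_++_`.
data Split (m n : ℕ) : Fin (m ℕ.+ n) → Set where
  left  : (i : Fin m) → Split m n (i ↑ˡ n)
  right : (j : Fin n) → Split m n (m ↑ʳ j)

split : ∀ m {n} (i : Fin (m ℕ.+ n)) → Split m n i
split ℕ.zero  i       = right i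
split (suc m) zero    = left zero
split (suc m) (suc i) with split m i
... | left j  = left (suc j)
... | right j = right j

-- A run of `r` steps occupies `suc r` positions. In `cons r` the letter `false` is the step that
-- leads to the next run; the final run has none. The positions of `cons r` split as `suc r` plus
-- `suc k` by computation.
data Runs : ∀ {k} → Vec Bool k → Set where
  last : ∀ r → Runs (replicate r true)
  cons : ∀ r {k} {S : Vec Bool k} → Runs S → Runs (replicate r true ++ false ∷ S)

runs : ∀ {k} (S : Vec Bool k) → Runs S
runs []          = last 0
runs (false ∷ S) = cons 0 (runs S)
runs (true ∷ S) with runs S
... | last r   = last (suc r)
... | cons r R = cons (suc r) R

-- A run is a maximal set of consecutive positions joined by the steps of S.
reverseRuns : ∀ {k} {S : Vec Bool k} → Runs S → Fin (suc k) → Fin (suc k)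
reverseRuns (last r)           = opposite
reverseRuns (cons r {k = k} R) =
  join (suc r) (suc k) ∘ Sum.map opposite (reverseRuns R) ∘ splitAt (suc r)

reverseRuns-↑ˡ : ∀ r {k} {S : Vec Bool k} (R : Runs S) i →
                 reverseRuns (cons r R) (i ↑ˡ suc k) ≡ opposite i ↑ˡ suc k
reverseRuns-↑ˡ r {k} R i =
  cong (join (suc r) (suc k) ∘ Sum.map opposite (reverseRuns R)) (splitAt-↑ˡ (suc r) i (suc k))

reverseRuns-↑ʳ : ∀ r {k} {S : Vec Bool k} (R : Runs S) i →
                 reverseRuns (cons r R) (suc r ↑ʳ i) ≡ suc r ↑ʳ reverseRuns R i
reverseRuns-↑ʳ r {k} R i =
  cong (join (suc r) (suc k) ∘ Sum.map opposite (reverseRuns R)) (splitAt-↑ʳ (suc r) (suc k) i)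

reverseRuns-involutive : ∀ {k} {S : Vec Bool k} (R : Runs S) i → reverseRuns R (reverseRuns R i) ≡ i
reverseRuns-involutive (last r) i = opposite-involutive i
reverseRuns-involutive (cons r {k} R) i with split (suc r) i
... | left j  = trans (cong (reverseRuns (cons r R)) (reverseRuns-↑ˡ r R j))
                 (trans (reverseRuns-↑ˡ r R (opposite j)) (cong (_↑ˡ suc k) (opposite-involutive j)))
... | right j = trans (cong (reverseRuns (cons r R)) (reverseRuns-↑ʳ r R j))
                 (trans (reverseRuns-↑ʳ r R (reverseRuns R j)) (cong (suc r ↑ʳ_) (reverseRuns-involutive R j)))

opposite-inject₁ : ∀ {k} (i : Fin k) → opposite (inject₁ i) ≡ suc (opposite i)
opposite-inject₁ {suc k} zero    = refl
opposite-inject₁ {suc k} (suc i) = cong inject₁ (opposite-inject₁ i)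

inject₁-↑ˡ : ∀ {m} (i : Fin m) n → inject₁ (i ↑ˡ n) ≡ inject₁ i ↑ˡ n
inject₁-↑ˡ i n = toℕ-injective (trans (toℕ-inject₁ (i ↑ˡ n)) (trans (toℕ-↑ˡ i n)
                   (sym (trans (toℕ-↑ˡ (inject₁ i) n) (toℕ-inject₁ i)))))

inject₁-↑ʳ-suc : ∀ m {n} (i : Fin n) → inject₁ (m ↑ʳ suc i) ≡ suc m ↑ʳ inject₁ i
inject₁-↑ʳ-suc ℕ.zero  i = refl
inject₁-↑ʳ-suc (suc m) i = cong suc (inject₁-↑ʳ-suc m i)

-- Positions are reflected inside each run, so a step of `S` lands on a step of the same run with
-- its ends exchanged. The steps between runs carry `false` and are ruled out by the hypothesis on
-- `i`.
reverseRuns-step : ∀ {k} {S : Vec Bool k} (R : Runs S) i → lookup S i ≡ true → ∃ λ j →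
                   lookup S j ≡ true ×
                   reverseRuns R (inject₁ i) ≡ suc j × reverseRuns R (suc i) ≡ inject₁ j
reverseRuns-step (last r) i _ =
  opposite i , lookup-replicate (opposite i) true , opposite-inject₁ i , refl
reverseRuns-step (cons r {k} {S} R) i Sᵢ with split r i
... | left j =
  opposite j ↑ˡ suc k ,
  trans (lookup-++ˡ (replicate r true) (false ∷ S) (opposite j)) (lookup-replicate (opposite j) true) ,
  trans (cong (reverseRuns (cons r R)) (inject₁-↑ˡ j (suc k)))
    (trans (reverseRuns-↑ˡ r R (inject₁ j)) (cong (_↑ˡ suc k) (opposite-inject₁ j))) ,
  trans (reverseRuns-↑ˡ r R (suc j)) (sym (inject₁-↑ˡ (opposite j) (suc k)))
... | right zero with () ← trans (sym Sᵢ) (lookup-++ʳ (replicate r true) (false ∷ S) zero)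
... | right (suc j)
  with l , Sₗ , eq₁ , eq₂ ← reverseRuns-step R j
         (trans (sym (lookup-++ʳ (replicate r true) (false ∷ S) (suc j))) Sᵢ) =
  r ↑ʳ suc l ,
  trans (lookup-++ʳ (replicate r true) (false ∷ S) (suc l)) Sₗ ,
  trans (cong (reverseRuns (cons r R)) (inject₁-↑ʳ-suc r j))
    (trans (reverseRuns-↑ʳ r R (inject₁ j)) (cong (suc r ↑ʳ_) eq₁)) ,
  trans (reverseRuns-↑ʳ r R (suc j)) (trans (cong (suc r ↑ʳ_) eq₂) (sym (inject₁-↑ʳ-suc r l)))

-- Reversal and reindexing of vectors

lookup-∷ʳ-fromℕ : ∀ {A : Set} {n} (xs : Vec A n) x → lookup (xs ∷ʳ x) (fromℕ n) ≡ x
lookup-∷ʳ-fromℕ []       x = refl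
lookup-∷ʳ-fromℕ (_ ∷ xs) x = lookup-∷ʳ-fromℕ xs x

lookup-∷ʳ-inject₁ : ∀ {A : Set} {n} (xs : Vec A n) x i → lookup (xs ∷ʳ x) (inject₁ i) ≡ lookup xs i
lookup-∷ʳ-inject₁ (_ ∷ xs) x zero    = refl
lookup-∷ʳ-inject₁ (_ ∷ xs) x (suc i) = lookup-∷ʳ-inject₁ xs x i

lookup-reverse-opposite : ∀ {A : Set} {n} (xs : Vec A n) i → lookup (reverse xs) (opposite i) ≡ lookup xs i
lookup-reverse-opposite (x ∷ xs) zero rewrite reverse-∷ x xs = lookup-∷ʳ-fromℕ (reverse xs) x
lookup-reverse-opposite (x ∷ xs) (suc i) rewrite reverse-∷ x xs =
  trans (lookup-∷ʳ-inject₁ (reverse xs) x (opposite i)) (lookup-reverse-opposite xs i)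

lookup-reverse : ∀ {A : Set} {n} (xs : Vec A n) i → lookup (reverse xs) i ≡ lookup xs (opposite i)
lookup-reverse xs i = trans (cong (lookup (reverse xs)) (sym (opposite-involutive i)))
                            (lookup-reverse-opposite xs (opposite i))

reindex : ∀ {A : Set} {n} → (Fin n → Fin n) → Vec A n → Vec A n
reindex π xs = tabulate (lookup xs ∘ π)

reindex-unique : ∀ {A : Set} {n} (π : Fin n → Fin n) {xs : Vec A n} → (∀ i → π (π i) ≡ i) →
                 Unique xs → Unique (reindex π xs)
reindex-unique π ππ xs! = tabulate⁺ λ {i} {j} eq →
  trans (sym (ππ i)) (trans (cong π (lookup-injective xs! (π i) (π j) eq)) (ππ j))

reindex-involutive : ∀ {A : Set} {n} (π : Fin n → Fin n) → (∀ i → π (π i) ≡ i) →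
                     (xs : Vec A n) → reindex π (reindex π xs) ≡ xs
reindex-involutive π ππ xs = trans
  (tabulate-cong λ i → trans (lookup∘tabulate (lookup xs ∘ π) (π i)) (cong (lookup xs) (ππ i)))
  (tabulate∘lookup xs)

reverse-unique : ∀ {A : Set} {n} {xs : Vec A n} → Unique xs → Unique (reverse xs)
reverse-unique {xs = xs} xs! = subst Unique
  (trans (tabulate-cong λ i → sym (lookup-reverse xs i)) (tabulate∘lookup (reverse xs)))
  (reindex-unique opposite opposite-involutive xs!)

does-true⇒ : {P : Set} (P? : Dec P) → does P? ≡ true → P
does-true⇒ (yes p) _ = p

length-filter-map : {A B : Set} {P : B → Set} (P? : Decidable P) (g : A → B) (xs : List A) →
                    length (filter P? (List.map g xs)) ≡ length (filter (P? ∘ g) xs)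
length-filter-map P? g []       = refl
length-filter-map P? g (x ∷ xs) with does (P? (g x))
... | true  = cong suc (length-filter-map P? g xs)
... | false = length-filter-map P? g xs

lookup-extensional : ∀ {A : Set} {n} {xs ys : Vec A n} → (∀ i → lookup xs i ≡ lookup ys i) → xs ≡ ys
lookup-extensional {xs = xs} {ys} eq = trans (sym (tabulate∘lookup xs)) (trans (tabulate-cong eq) (tabulate∘lookup ys))

-- Words of types and their symmetries

-- `converse w` is what the reversed enumeration reads: the steps come in the opposite order and
-- each is traversed the other way.
complement converse : ∀ {k} → Vec Bool k → Vec Bool k
complement = Vec.map not
converse w = complement (reverse w)

complement-involutive : ∀ {k} (w : Vec Bool k) → complement (complement w) ≡ w
complement-involutive []      = refl
complement-involutive (b ∷ w) = cong₂ _∷_ (not-involutive b) (complement-involutive w)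

converse-complement : ∀ {k} (w : Vec Bool k) → converse (complement w) ≡ reverse w
converse-complement w = trans (cong complement (sym (map-reverse not w))) (complement-involutive (reverse w))

converse-involutive : ∀ {k} (w : Vec Bool k) → converse (converse w) ≡ w
converse-involutive w = trans (converse-complement (reverse w)) (reverse-involutive w)

UpToConverse : ∀ {k} → Rel (Vec Bool k) 0ℓ
UpToConverse w v = v ≡ w ⊎ v ≡ converse w

upToConverse? : ∀ {k} (w v : Vec Bool k) → Dec (UpToConverse w v)
upToConverse? w v = ≡-decᵛ _≟ᵇ_ v w ⊎-dec ≡-decᵛ _≟ᵇ_ v (converse w)

upToConverse-complement : ∀ {k} (w v : Vec Bool k) → UpToConverse w (complement v) → UpToConverse (complement w) v
upToConverse-complement w v = Sum.map
  (λ eq → trans (sym (complement-involutive v)) (cong complement eq))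
  (λ eq → trans (sym (complement-involutive v)) (trans (cong complement eq)
            (trans (complement-involutive (reverse w)) (sym (converse-complement w)))))

word : ∀ {s} (γ : Vec ℤ s) → Vec Bool (size γ)
word []      = []
word (c ∷ γ) = replicate ℤ.∣ c ∣ (does (0ℤ ℤₚ.<? c)) ++ word γ

-- `β` is the sign of the preceding block, `true` for positive. At the start of a path it belongs to
-- a fictitious block of the sign opposite to the first entry.
Alternates : ∀ {s} → Bool → Vec ℤ s → Set
Alternates β []      = ⊤
Alternates β (c ∷ γ) = ℤ.NonZero c × does (0ℤ ℤₚ.<? c) ≡ not β × Alternates (does (0ℤ ℤₚ.<? c)) γ

-- Direction words of enumerations in a tournament

module _ {n : ℕ} (𝒯 : Tournament n) where
  open Tournament 𝒯

  ⟶-asym : ∀ {u v} → u ⟶ v → ¬ (v ⟶ u)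
  ⟶-asym {u} {v} u⟶v v⟶u with trichotomous u v
  ... | tri< _ _ v↛u = v↛u v⟶u
  ... | tri≈ u↛v _ _ = u↛v u⟶v
  ... | tri> u↛v _ _ = u↛v u⟶v

  ⟶-total : ∀ {u v} → u ≢ v → u ⟶ v ⊎ v ⟶ u
  ⟶-total {u} {v} u≢v with trichotomous u v
  ... | tri< u⟶v _ _ = inj₁ u⟶v
  ... | tri≈ _ u≡v _ = contradiction u≡v u≢v
  ... | tri> _ _ v⟶u = inj₂ v⟶u

  ⟶?-swap : ∀ {u v} → u ≢ v → does (u ⟶? v) ≡ not (does (v ⟶? u))
  ⟶?-swap {u} {v} u≢v with u ⟶? v | v ⟶? u
  ... | yes u⟶v | yes v⟶u = contradiction v⟶u (⟶-asym u⟶v)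
  ... | yes _   | no  _   = refl
  ... | no  _   | yes _   = refl
  ... | no  u↛v | no  v↛u = ⊥-elim ([ u↛v , v↛u ]′ (⟶-total u≢v))

  dirs : ∀ {k} → Vec (Fin n) (suc k) → Vec Bool k
  dirs p = tabulate λ i → does (lookup p (inject₁ i) ⟶? lookup p (suc i))

  lookup-dirs : ∀ {k} (p : Vec (Fin n) (suc k)) i →
                lookup (dirs p) i ≡ does (lookup p (inject₁ i) ⟶? lookup p (suc i))
  lookup-dirs p i = lookup∘tabulate (λ i → does (lookup p (inject₁ i) ⟶? lookup p (suc i))) i

  inject₁≢suc : ∀ {k} (i : Fin k) → inject₁ i ≢ suc i
  inject₁≢suc i eq = ℕₚ.1+n≢n (trans (sym (cong toℕ eq)) (toℕ-inject₁ i))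

  step-distinct : ∀ {k} {p : Vec (Fin n) (suc k)} → Unique p → ∀ i → lookup p (inject₁ i) ≢ lookup p (suc i)
  step-distinct p! i eq = inject₁≢suc i (lookup-injective p! _ _ eq)

  -- The common core of reversing a path and reversing runs. Distinctness of the two ends is what
  -- makes exactly one direction hold.
  dirs-swap : ∀ {k} {p : Vec (Fin n) (suc k)} (q : Vec (Fin n) (suc k)) → Unique p → ∀ {i j} →
              lookup q (inject₁ i) ≡ lookup p (suc j) → lookup q (suc i) ≡ lookup p (inject₁ j) →
              lookup (dirs q) i ≡ not (lookup (dirs p) j)
  dirs-swap {p = p} q p! {i} {j} eq₁ eq₂ = begin
    lookup (dirs q) i                                          ≡⟨ lookup-dirs q i ⟩
    does (lookup q (inject₁ i) ⟶? lookup q (suc i))            ≡⟨ cong₂ (λ u v → does (u ⟶? v)) eq₁ eq₂ ⟩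
    does (lookup p (suc j) ⟶? lookup p (inject₁ j))            ≡⟨ ⟶?-swap (step-distinct p! j ∘ sym) ⟩
    not (does (lookup p (inject₁ j) ⟶? lookup p (suc j)))      ≡⟨ cong not (lookup-dirs p j) ⟨
    not (lookup (dirs p) j)                                    ∎
    where open ≡-Reasoning

  dirs-reverse : ∀ {k} {p : Vec (Fin n) (suc k)} → Unique p → dirs (reverse p) ≡ converse (dirs p)
  dirs-reverse {p = p} p! = lookup-extensional λ i →
    let at-inject₁ = trans (lookup-reverse p (inject₁ i)) (cong (lookup p) (opposite-inject₁ i)) in begin
    lookup (dirs (reverse p)) i              ≡⟨ dirs-swap (reverse p) p! at-inject₁ (lookup-reverse p (suc i)) ⟩
    not (lookup (dirs p) (opposite i))       ≡⟨ cong not (lookup-reverse (dirs p) i) ⟨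
    not (lookup (reverse (dirs p)) i)        ≡⟨ lookup-map i not (reverse (dirs p)) ⟨
    lookup (converse (dirs p)) i             ∎
    where open ≡-Reasoning

  dirs-reverseRuns : ∀ {k} {p : Vec (Fin n) (suc k)} → Unique p → ∀ {S} (R : Runs S) i →
                     lookup S i ≡ true → ∃ λ j →
                     lookup S j ≡ true × lookup (dirs (reindex (reverseRuns R) p)) i ≡ not (lookup (dirs p) j)
  dirs-reverseRuns {p = p} p! R i Sᵢ with j , Sⱼ , eq₁ , eq₂ ← reverseRuns-step R i Sᵢ =
    j , Sⱼ , dirs-swap (reindex (reverseRuns R) p) p!
      (trans (lookup∘tabulate (lookup p ∘ reverseRuns R) (inject₁ i)) (cong (lookup p) eq₁))
      (trans (lookup∘tabulate (lookup p ∘ reverseRuns R) (suc i)) (cong (lookup p) eq₂))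

  paths : ∀ k → List (Vec (Fin n) (suc k))
  paths k = filter (allPairs? λ u v → ¬? (u ≟ᶠ v)) (allVecs n (suc k))

  paths! : ∀ k → Uniqueˡ (paths k)
  paths! k = Uniqueˡ.filter⁺ _ (allVecs! n (suc k))

  ∈-paths⁺ : ∀ {k} {p : Vec (Fin n) (suc k)} → Unique p → p ∈ paths k
  ∈-paths⁺ {p = p} p! = ∈-filter⁺ _ (∈-allVecs p) p!

  ∈-paths⁻ : ∀ {k} {p : Vec (Fin n) (suc k)} → p ∈ paths k → Unique p
  ∈-paths⁻ {k} p∈ = proj₂ (∈-filter⁻ _ {xs = allVecs n (suc k)} p∈)

  -- The involution `φ` keeps `S` stable and flips each of its steps, so the same map serves in both
  -- directions between enumerations forward on `S` and those backward on `S`.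
  supersets-dirs : ∀ {k} (S : Vec Bool k) →
                   supersets S (List.map dirs (paths k)) ≡ supersets S (List.map (complement ∘ dirs) (paths k))
  supersets-dirs {k} S = begin
    supersets S (List.map dirs (paths k))
      ≡⟨ length-filter-map (T? ∘ (S ⊆ᵇ_)) dirs (paths k) ⟩
    length (filter (T? ∘ (S ⊆ᵇ_) ∘ dirs) (paths k))
      ≡⟨ bijection⇒length (Uniqueˡ.filter⁺ _ (paths! k)) (Uniqueˡ.filter⁺ _ (paths! k)) φ φ to from φφ φφ ⟩
    length (filter (T? ∘ (S ⊆ᵇ_) ∘ complement ∘ dirs) (paths k))
      ≡⟨ length-filter-map (T? ∘ (S ⊆ᵇ_)) (complement ∘ dirs) (paths k) ⟨
    supersets S (List.map (complement ∘ dirs) (paths k)) ∎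
    where
    open ≡-Reasoning

    R : Runs S
    R = runs S

    φ : Vec (Fin n) (suc k) → Vec (Fin n) (suc k)
    φ = reindex (reverseRuns R)

    φφ : ∀ p → φ (φ p) ≡ p
    φφ = reindex-involutive (reverseRuns R) (reverseRuns-involutive R)

    to : ∀ {p} → p ∈ filter (T? ∘ (S ⊆ᵇ_) ∘ dirs) (paths k) →
         φ p ∈ filter (T? ∘ (S ⊆ᵇ_) ∘ complement ∘ dirs) (paths k)
    to {p} p∈
      with p∈paths , t ← ∈-filter⁻ (T? ∘ (S ⊆ᵇ_) ∘ dirs) {xs = paths k} p∈
      with p! ← ∈-paths⁻ p∈paths =
      ∈-filter⁺ _ (∈-paths⁺ (reindex-unique (reverseRuns R) (reverseRuns-involutive R) p!)) (⊆⇒⊆ᵇ S _ λ i Sᵢ →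
        let j , Sⱼ , eq = dirs-reverseRuns p! R i Sᵢ in
        trans (lookup-map i not (dirs (φ p))) (trans (cong not eq)
          (trans (not-involutive _) (⊆ᵇ⇒⊆ S (dirs p) t j Sⱼ))))

    from : ∀ {p} → p ∈ filter (T? ∘ (S ⊆ᵇ_) ∘ complement ∘ dirs) (paths k) →
           φ p ∈ filter (T? ∘ (S ⊆ᵇ_) ∘ dirs) (paths k)
    from {p} p∈
      with p∈paths , t ← ∈-filter⁻ (T? ∘ (S ⊆ᵇ_) ∘ complement ∘ dirs) {xs = paths k} p∈
      with p! ← ∈-paths⁻ p∈paths =
      ∈-filter⁺ _ (∈-paths⁺ (reindex-unique (reverseRuns R) (reverseRuns-involutive R) p!)) (⊆⇒⊆ᵇ S _ λ i Sᵢ →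
        let j , Sⱼ , eq = dirs-reverseRuns p! R i Sᵢ in
        trans eq (trans (sym (lookup-map j not (dirs p))) (⊆ᵇ⇒⊆ S (complement (dirs p)) t j Sⱼ)))

  dirs-↭ : ∀ k → List.map dirs (paths k) ↭ List.map (complement ∘ dirs) (paths k)
  dirs-↭ k = supersets⇒↭ _ _ supersets-dirs

  enumerations : ∀ {k} → Vec Bool k → ℕ
  enumerations {k} w = length (filter (upToConverse? w ∘ dirs) (paths k))

  -- The permutation `dirs-↭` puts a complement on every word read; the symmetry of `UpToConverse`
  -- then moves it onto `w`.
  enumerations-complement : ∀ {k} (w : Vec Bool k) → enumerations w ≡ enumerations (complement w)
  enumerations-complement {k} w = begin
    length (filter (upToConverse? w ∘ dirs) (paths k))
      ≡⟨ length-filter-map (upToConverse? w) dirs (paths k) ⟨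
    length (filter (upToConverse? w) (List.map dirs (paths k)))
      ≡⟨ ↭-length (filter-↭ (upToConverse? w) (dirs-↭ k)) ⟩
    length (filter (upToConverse? w) (List.map (complement ∘ dirs) (paths k)))
      ≡⟨ length-filter-map (upToConverse? w) (complement ∘ dirs) (paths k) ⟩
    length (filter (upToConverse? w ∘ complement ∘ dirs) (paths k))
      ≡⟨ cong length (filter-≐ _ _ ((λ {p} → to {p}) , (λ {p} → from {p})) (paths k)) ⟩
    length (filter (upToConverse? (complement w) ∘ dirs) (paths k)) ∎
    where
    open ≡-Reasoning

    to : ∀ {p} → UpToConverse w (complement (dirs p)) → UpToConverse (complement w) (dirs p)
    to {p} = upToConverse-complement w (dirs p)

    from : ∀ {p} → UpToConverse (complement w) (dirs p) → UpToConverse w (complement (dirs p))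
    from {p} h = subst (λ v → UpToConverse v (complement (dirs p))) (complement-involutive w)
      (upToConverse-complement (complement w) (complement (dirs p))
        (subst (UpToConverse (complement w)) (sym (complement-involutive (dirs p))) h))

  -- Blocks of a path against its direction word

  module _ {k : ℕ} {p : Vec (Fin n) (suc k)} (p! : Unique p) where

    d : Fin k → Bool
    d = lookup (dirs p)

    ⟶⇒true : ∀ i → lookup p (inject₁ i) ⟶ lookup p (suc i) → d i ≡ true
    ⟶⇒true i s = trans (lookup-dirs p i) (dec-true (lookup p (inject₁ i) ⟶? lookup p (suc i)) s)

    true⇒⟶ : ∀ i → d i ≡ true → lookup p (inject₁ i) ⟶ lookup p (suc i)
    true⇒⟶ i dᵢ = does-true⇒ (lookup p (inject₁ i) ⟶? lookup p (suc i)) (trans (sym (lookup-dirs p i)) dᵢ)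

    ⟵⇒false : ∀ i → lookup p (suc i) ⟶ lookup p (inject₁ i) → d i ≡ false
    ⟵⇒false i s = trans (lookup-dirs p i) (dec-false (lookup p (inject₁ i) ⟶? lookup p (suc i)) (⟶-asym s))

    false⇒⟵ : ∀ i → d i ≡ false → lookup p (suc i) ⟶ lookup p (inject₁ i)
    false⇒⟵ i dᵢ with ⟶-total (step-distinct p! i)
    ... | inj₁ s with () ← trans (sym dᵢ) (⟶⇒true i s)
    ... | inj₂ s = s

    -- A single letter `β` covers both senses of a directed segment, and step `i` is located by its
    -- own number rather than by its two end positions.
    Constant : Bool → Rel (Fin (suc k)) 0ℓ
    Constant β a b = ∀ i → toℕ a ℕ.≤ toℕ i → toℕ i ℕ.< toℕ b → d i ≡ β

    forward⇒constant : ∀ {a b} → Forward 𝒯 p a b → Constant true a b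
    forward⇒constant fw i a≤i i<b = ⟶⇒true i (fw i (subst (_ ℕ.≤_) (sym (toℕ-inject₁ i)) a≤i) i<b)

    constant⇒forward : ∀ {a b} → Constant true a b → Forward 𝒯 p a b
    constant⇒forward const i a≤i i<b = true⇒⟶ i (const i (subst (_ ℕ.≤_) (toℕ-inject₁ i) a≤i) i<b)

    backward⇒constant : ∀ {a b} → Backward 𝒯 p a b → Constant false a b
    backward⇒constant bw i a≤i i<b = ⟵⇒false i (bw i (subst (_ ℕ.≤_) (sym (toℕ-inject₁ i)) a≤i) i<b)

    constant⇒directed : ∀ β {a b} → Constant β a b → Directed 𝒯 p a b
    constant⇒directed true  const = inj₁ (constant⇒forward const)
    constant⇒directed false const = inj₂ λ i a≤i i<b →
      false⇒⟵ i (const i (subst (_ ℕ.≤_) (toℕ-inject₁ i) a≤i) i<b)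

    directed⇒constant : ∀ {a b} → Directed 𝒯 p a b → ∃ λ β → Constant β a b
    directed⇒constant (inj₁ fw) = true , forward⇒constant fw
    directed⇒constant (inj₂ bw) = false , backward⇒constant bw

    -- Steps of `p` and letters of `word γ` are indexed by different `Fin` types, so the offset `a`
    -- is expressed through `toℕ`.
    Reads : ∀ {s} → Fin (suc k) → Vec ℤ s → Set
    Reads a γ = ∀ i j → toℕ i ≡ toℕ a ℕ.+ toℕ j → d i ≡ lookup (word γ) j

    blocks⇒reads : ∀ {s} (γ : Vec ℤ s) {a} → Blocks 𝒯 p a γ → Reads a γ
    blocks⇒reads (c ∷ γ) {a} (b , (_ , dir , _) , b≡ , fw⇔ , rest) i j i≡ with split ℤ.∣ c ∣ j
    ... | left j′ = trans (constant (0ℤ ℤₚ.<? c) dir i a≤i i<b)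
        (sym (trans (lookup-++ˡ (replicate ℤ.∣ c ∣ _) (word γ) j′) (lookup-replicate j′ _)))
      where
      i≡′ : toℕ i ≡ toℕ a ℕ.+ toℕ j′
      i≡′ = trans i≡ (cong (toℕ a ℕ.+_) (toℕ-↑ˡ j′ (size γ)))

      a≤i : toℕ a ℕ.≤ toℕ i
      a≤i = subst (toℕ a ℕ.≤_) (sym i≡′) (ℕₚ.m≤m+n (toℕ a) (toℕ j′))

      i<b : toℕ i ℕ.< toℕ b
      i<b = subst (ℕ._< toℕ b) (sym i≡′)
              (subst (toℕ a ℕ.+ toℕ j′ ℕ.<_) (sym b≡) (ℕₚ.+-monoʳ-< (toℕ a) (toℕ<n j′)))

      -- `fw⇔` only decides whether the block is forward; a directed segment that is not forward is
      -- backward.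
      constant : (c>0? : Dec (0ℤ < c)) → Directed 𝒯 p a b → Constant (does c>0?) a b
      constant (yes c>0) _         = forward⇒constant (Equivalence.from fw⇔ c>0)
      constant (no c≯0)  (inj₁ fw) = contradiction (Equivalence.to fw⇔ fw) c≯0
      constant (no c≯0)  (inj₂ bw) = backward⇒constant bw
    ... | right j′ = trans (blocks⇒reads γ rest i j′ i≡′) (sym (lookup-++ʳ (replicate ℤ.∣ c ∣ _) (word γ) j′))
      where
      i≡′ : toℕ i ≡ toℕ b ℕ.+ toℕ j′
      i≡′ = trans i≡ (trans (cong (toℕ a ℕ.+_) (toℕ-↑ʳ ℤ.∣ c ∣ j′))
              (trans (sym (ℕₚ.+-assoc (toℕ a) _ _)) (cong (ℕ._+ toℕ j′) (sym b≡))))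

    -- Serves the maximality of a block on its right: the step after its end, if there is one,
    -- carries the opposite letter.
    reads-next : ∀ {s} (γ : Vec ℤ s) {β b} → Alternates β γ → toℕ b ℕ.+ size γ ≡ k → Reads b γ →
                 ∀ i → toℕ i ≡ toℕ b → d i ≡ not β
    reads-next []      {b = b} _ b≡ _ i i≡ = contradiction (toℕ<n i) (ℕₚ.≤⇒≯ (ℕₚ.≤-reflexive
      (trans (sym b≡) (trans (ℕₚ.+-identityʳ (toℕ b)) (sym i≡)))))
    reads-next (ℤ.+[1+ m ] ∷ γ) {b = b} (_ , sign , _) _ reads i i≡ =
      trans (reads i zero (trans i≡ (sym (ℕₚ.+-identityʳ (toℕ b))))) sign
    reads-next (ℤ.-[1+ m ] ∷ γ) {b = b} (_ , sign , _) _ reads i i≡ =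
      trans (reads i zero (trans i≡ (sym (ℕₚ.+-identityʳ (toℕ b))))) sign

    -- Induction along `γ`, carrying the letter `β` of the step just before `a`. Alternation makes
    -- it differ from the first letter of the current block, which gives maximality on the left;
    -- `reads-next` gives it on the right.
    reads⇒blocks : ∀ {s} (γ : Vec ℤ s) {a β} → Alternates β γ → toℕ a ℕ.+ size γ ≡ k →
                   (∀ i → suc (toℕ i) ≡ toℕ a → d i ≡ β) → Reads a γ → Blocks 𝒯 p a γ
    reads⇒blocks []      {a} _ a≡ _ _ =
      toℕ-injective (trans (sym (ℕₚ.+-identityʳ (toℕ a))) (trans a≡ (sym (toℕ-fromℕ k))))
    reads⇒blocks (c ∷ γ) {a} {β} (c≢0 , sign , alt) a≡ before reads =
      b , (a<b , constant⇒directed σ const , maximal) , b≡ , mk⇔ to from ,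
      reads⇒blocks γ alt b+ before′ reads′
      where
      σ : Bool
      σ = does (0ℤ ℤₚ.<? c)

      b≤k : toℕ a ℕ.+ ℤ.∣ c ∣ ℕ.≤ k
      b≤k = subst (toℕ a ℕ.+ ℤ.∣ c ∣ ℕ.≤_) (trans (ℕₚ.+-assoc (toℕ a) _ _) a≡) (ℕₚ.m≤m+n _ (size γ))

      b : Fin (suc k)
      b = fromℕ< (ℕ.s≤s b≤k)

      b≡ : toℕ b ≡ toℕ a ℕ.+ ℤ.∣ c ∣
      b≡ = toℕ-fromℕ< (ℕ.s≤s b≤k)

      b+ : toℕ b ℕ.+ size γ ≡ k
      b+ = trans (cong (ℕ._+ size γ) b≡) (trans (ℕₚ.+-assoc (toℕ a) _ _) a≡)

      a<b : toℕ a ℕ.< toℕ b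
      a<b = subst (toℕ a ℕ.<_) (sym b≡) (ℕₚ.m<m+n (toℕ a) (ℕ.>-nonZero⁻¹ ℤ.∣ c ∣ {{c≢0}}))

      const : Constant σ a b
      const i a≤i i<b = trans (reads i (j ↑ˡ size γ) i≡)
        (trans (lookup-++ˡ (replicate ℤ.∣ c ∣ σ) (word γ) j) (lookup-replicate j σ))
        where
        j< : toℕ i ℕ.∸ toℕ a ℕ.< ℤ.∣ c ∣
        j< = ℕₚ.+-cancelˡ-< (toℕ a) _ _
               (subst (ℕ._< toℕ a ℕ.+ ℤ.∣ c ∣) (sym (ℕₚ.m+[n∸m]≡n a≤i)) (subst (toℕ i ℕ.<_) b≡ i<b))

        j : Fin ℤ.∣ c ∣
        j = fromℕ< j<

        i≡ : toℕ i ≡ toℕ a ℕ.+ toℕ (j ↑ˡ size γ)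
        i≡ = trans (sym (ℕₚ.m+[n∸m]≡n a≤i))
               (cong (toℕ a ℕ.+_) (sym (trans (toℕ-↑ˡ j (size γ)) (toℕ-fromℕ< j<))))

      before′ : ∀ i → suc (toℕ i) ≡ toℕ b → d i ≡ σ
      before′ i i+1≡b = const i (ℕ.s≤s⁻¹ (subst (toℕ a ℕ.<_) (sym i+1≡b) a<b)) (ℕₚ.≤-reflexive i+1≡b)

      reads′ : Reads b γ
      reads′ i j i≡ = trans (reads i (ℤ.∣ c ∣ ↑ʳ j) (trans i≡ (trans (cong (ℕ._+ toℕ j) b≡)
          (trans (ℕₚ.+-assoc (toℕ a) _ _) (cong (toℕ a ℕ.+_) (sym (toℕ-↑ʳ ℤ.∣ c ∣ j)))))))
        (lookup-++ʳ (replicate ℤ.∣ c ∣ σ) (word γ) j)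

      -- A nonzero entry gives a nonempty block. Its first step reveals the letter of the block and
      -- of any directed segment containing it.
      first : Fin k
      first = fromℕ< (ℕₚ.<-≤-trans a<b (ℕ.s≤s⁻¹ (toℕ<n b)))

      first≡ : toℕ first ≡ toℕ a
      first≡ = toℕ-fromℕ< (ℕₚ.<-≤-trans a<b (ℕ.s≤s⁻¹ (toℕ<n b)))

      d-first : d first ≡ σ
      d-first = const first (ℕₚ.≤-reflexive (sym first≡)) (subst (ℕ._< toℕ b) (sym first≡) a<b)

      to : Forward 𝒯 p a b → 0ℤ < c
      to fw = does-true⇒ (0ℤ ℤₚ.<? c) (trans (sym d-first)
        (forward⇒constant fw first (ℕₚ.≤-reflexive (sym first≡)) (subst (ℕ._< toℕ b) (sym first≡) a<b)))

      from : 0ℤ < c → Forward 𝒯 p a b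
      from c>0 = constant⇒forward (subst (λ β → Constant β a b) (dec-true (0ℤ ℤₚ.<? c) c>0) const)

      maximal : ∀ a′ b′ → toℕ a′ ℕ.≤ toℕ a → toℕ b ℕ.≤ toℕ b′ → Directed 𝒯 p a′ b′ → a′ ≡ a × b′ ≡ b
      maximal a′ b′ a′≤a b≤b′ dir with directed⇒constant dir
      ... | τ , const′ = toℕ-injective (ℕₚ.≤-antisym a′≤a (ℕₚ.≮⇒≥ a′≮a)) ,
                         toℕ-injective (ℕₚ.≤-antisym (ℕₚ.≮⇒≥ b≮b′) b≤b′)
        where
        σ≡τ : σ ≡ τ
        σ≡τ = trans (sym d-first) (const′ first (subst (toℕ a′ ℕ.≤_) (sym first≡) a′≤a)
          (subst (ℕ._< toℕ b′) (sym first≡) (ℕₚ.<-≤-trans a<b b≤b′)))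

        -- A segment starting earlier would contain the step numbered `toℕ a` minus one, whose
        -- letter is `β` and not `σ`.
        a′≮a : ¬ (toℕ a′ ℕ.< toℕ a)
        a′≮a a′<a = not-¬ (trans (sym (const′ i a′≤i i<b′)) (before i i+1≡a)) (trans (sym σ≡τ) sign)
          where
          suc-pred-a : suc (ℕ.pred (toℕ a)) ≡ toℕ a
          suc-pred-a = ℕₚ.suc-pred (toℕ a) {{ℕ.>-nonZero (ℕₚ.≤-<-trans ℕ.z≤n a′<a)}}

          a-1<k : ℕ.pred (toℕ a) ℕ.< k
          a-1<k = subst (ℕ._≤ k) (sym suc-pred-a) (ℕ.s≤s⁻¹ (toℕ<n a))

          i : Fin k
          i = fromℕ< a-1<k

          i+1≡a : suc (toℕ i) ≡ toℕ a
          i+1≡a = trans (cong suc (toℕ-fromℕ< a-1<k)) suc-pred-a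

          a′≤i : toℕ a′ ℕ.≤ toℕ i
          a′≤i = ℕ.s≤s⁻¹ (subst (toℕ a′ ℕ.<_) (sym i+1≡a) a′<a)

          i<b′ : toℕ i ℕ.< toℕ b′
          i<b′ = ℕₚ.≤-trans (ℕₚ.≤-reflexive i+1≡a) (ℕₚ.≤-trans (ℕₚ.<⇒≤ a<b) b≤b′)

        b≮b′ : ¬ (toℕ b ℕ.< toℕ b′)
        b≮b′ b<b′ = not-¬ (sym σ≡τ) (trans (sym (const′ i a′≤i i<b′)) (reads-next γ alt b+ reads′ i i≡b))
          where
          b<k : toℕ b ℕ.< k
          b<k = ℕₚ.<-≤-trans b<b′ (ℕ.s≤s⁻¹ (toℕ<n b′))

          i : Fin k
          i = fromℕ< b<k

          i≡b : toℕ i ≡ toℕ b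
          i≡b = toℕ-fromℕ< b<k

          a′≤i : toℕ a′ ℕ.≤ toℕ i
          a′≤i = subst (toℕ a′ ℕ.≤_) (sym i≡b) (ℕₚ.≤-trans a′≤a (ℕₚ.<⇒≤ a<b))

          i<b′ : toℕ i ℕ.< toℕ b′
          i<b′ = subst (ℕ._< toℕ b′) (sym i≡b) b<b′

-- Recovering an enumeration from its adjacencies

-- The undirected part of `Arc`: equality of paths becomes a question about vertex sequences alone.
Adjacent : ∀ {A : Set} {k} → Vec A (suc k) → Rel A 0ℓ
Adjacent {k = k} p u v = ∃ λ (i : Fin k) →
  (lookup p (inject₁ i) ≡ u × lookup p (suc i) ≡ v) ⊎
  (lookup p (inject₁ i) ≡ v × lookup p (suc i) ≡ u)

infix 4 _⊑_

_⊑_ : ∀ {A : Set} {k} → Rel (Vec A (suc k)) 0ℓ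
p ⊑ q = ∀ {u v} → Adjacent p u v → Adjacent q u v

adjacent-sym : ∀ {A : Set} {k} {p : Vec A (suc k)} {u v} → Adjacent p u v → Adjacent p v u
adjacent-sym (i , adj) = i , Sum.swap adj

lookup-reverse-inject₁ : ∀ {A : Set} {k} (p : Vec A (suc k)) i →
                         lookup (reverse p) (inject₁ (opposite i)) ≡ lookup p (suc i)
lookup-reverse-inject₁ p i = lookup-reverse-opposite p (suc i)

lookup-reverse-suc : ∀ {A : Set} {k} (p : Vec A (suc k)) i →
                     lookup (reverse p) (suc (opposite i)) ≡ lookup p (inject₁ i)
lookup-reverse-suc p i =
  trans (cong (lookup (reverse p)) (sym (opposite-inject₁ i))) (lookup-reverse-opposite p (inject₁ i))

⊑-reverse : ∀ {A : Set} {k} (p : Vec A (suc k)) → p ⊑ reverse p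
⊑-reverse p (i , adj) = opposite i , Sum.swap (Sum.map reversed reversed adj)
  where
  reversed : ∀ {u v} → lookup p (inject₁ i) ≡ u × lookup p (suc i) ≡ v →
             lookup (reverse p) (inject₁ (opposite i)) ≡ v × lookup (reverse p) (suc (opposite i)) ≡ u
  reversed (eq₁ , eq₂) = trans (lookup-reverse-inject₁ p i) eq₂ , trans (lookup-reverse-suc p i) eq₁

reverse-⊑ : ∀ {A : Set} {k} (p : Vec A (suc k)) → reverse p ⊑ p
reverse-⊑ p adj = subst (λ q → Adjacent q _ _) (reverse-involutive p) (⊑-reverse (reverse p) adj)

head∉tail : ∀ {A : Set} {k x} {p : Vec A k} → Unique (x ∷ p) → ∀ i → lookup p i ≢ x
head∉tail xp! i eq with () ← lookup-injective xp! (suc i) zero eq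

-- `x` occurs only at the head of `x ∷ q`, so the edge from `x` to the next vertex of `p` must be
-- the first edge there too. No edge of the tail contains `x`, so the inclusion passes to the tails.
tails≡ : ∀ {A : Set} {k x} {p q : Vec A k} → Unique (x ∷ p) → Unique (x ∷ q) → x ∷ p ⊑ x ∷ q → p ≡ q
tails≡ {p = []}    {[]}    _   _   _ = refl
tails≡ {x = x} {y ∷ p} {z ∷ q} xp! xq! p⊑q with p⊑q (zero , inj₁ (refl , refl))
... | suc i , inj₁ (eq , _)   = contradiction eq (head∉tail xq! (inject₁ i))
... | suc i , inj₂ (_ , eq)   = contradiction eq (head∉tail xq! (suc i))
... | zero  , inj₂ (x≡y , _)  = contradiction (sym x≡y) (head∉tail xp! zero)
... | zero  , inj₁ (_ , refl) = cong (y ∷_) (tails≡ (AllPairs.tail xp!) (AllPairs.tail xq!) tail⊑)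
  where
  tail⊑ : y ∷ p ⊑ y ∷ q
  tail⊑ (i , adj) with p⊑q (suc i , adj)
  ... | suc j , adj′            = j , adj′
  ... | zero , inj₁ (refl , _) = ⊥-elim ([ head∉tail xp! (inject₁ i) ∘ proj₁ , head∉tail xp! (suc i) ∘ proj₂ ]′ adj)
  ... | zero , inj₂ (refl , _) = ⊥-elim ([ head∉tail xp! (suc i) ∘ proj₂ , head∉tail xp! (inject₁ i) ∘ proj₁ ]′ adj)

head-neighbour : ∀ {A : Set} {k x y} {p : Vec A k} → Unique (x ∷ y ∷ p) →
                 ∀ {v} → Adjacent (x ∷ y ∷ p) x v → v ≡ y
head-neighbour xyp! (zero  , inj₁ (_ , y≡v)) = sym y≡v
head-neighbour xyp! (zero  , inj₂ (_ , y≡x)) = contradiction y≡x (head∉tail xyp! zero)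
head-neighbour xyp! (suc i , inj₁ (eq , _))  = contradiction eq (head∉tail xyp! (inject₁ i))
head-neighbour xyp! (suc i , inj₂ (_ , eq))  = contradiction eq (head∉tail xyp! (suc i))

⊑∧head⇒≡ : ∀ {A : Set} {k} {p q : Vec A (suc k)} → Unique p → Unique q → p ⊑ q →
           lookup q zero ≡ lookup p zero → q ≡ p
⊑∧head⇒≡ {p = x ∷ p} {_ ∷ q} p! q! p⊑q refl = cong (x ∷_) (sym (tails≡ p! q! p⊑q))

-- An interior vertex has two neighbours.
sole-neighbour⇒head : ∀ {A : Set} {k x y} {q : Vec A (suc k)} → Unique q → (∀ {v} → Adjacent q x v → v ≡ y) →
                      ∀ i → lookup q (inject₁ i) ≡ x → lookup q (suc i) ≡ y → lookup q zero ≡ x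
sole-neighbour⇒head q! sole zero    eq _   = eq
sole-neighbour⇒head {q = q} q! sole (suc i) eqx eqy
  with eq ← sole (inject₁ i , inj₂ (refl , eqx)) =
  contradiction (lookup-injective q! (inject₁ (inject₁ i)) (suc (suc i)) (trans eq (sym eqy)))
    λ eq′ → ℕₚ.m≢1+m+n (toℕ i) (trans (trans (sym (toℕ-inject₁ i)) (trans (sym (toℕ-inject₁ (inject₁ i))) (cong toℕ eq′)))
      (cong suc (sym (ℕₚ.+-comm (toℕ i) 1))))

-- The head `x` of `p` has one neighbour, hence is an end of `q`. The order in which the edge from
-- `x` to `y` appears in `q` tells which end; in the second case the argument is applied to
-- `reverse q`.
sameAdjacency⇒≡⊎reverse : ∀ {A : Set} {k} {p q : Vec A (suc (suc k))} → Unique p → Unique q →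
                          p ⊑ q → q ⊑ p → q ≡ p ⊎ q ≡ reverse p
sameAdjacency⇒≡⊎reverse {p = x ∷ y ∷ p} {q} p! q! p⊑q q⊑p with p⊑q (zero , inj₁ (refl , refl))
... | i , inj₁ (eqx , eqy) =
  inj₁ (⊑∧head⇒≡ p! q! p⊑q (sole-neighbour⇒head q! (head-neighbour p! ∘ q⊑p) i eqx eqy))
... | i , inj₂ (eqy , eqx) =
  inj₂ (sym (reverse-reverse (⊑∧head⇒≡ p! (reverse-unique q!) (⊑-reverse q ∘ p⊑q)
    (sole-neighbour⇒head (reverse-unique q!) (head-neighbour p! ∘ q⊑p ∘ reverse-⊑ q) (opposite i)
      (trans (lookup-reverse-inject₁ q i) eqx) (trans (lookup-reverse-suc q i) eqy)))))

-- With at least one step the first and last vertices differ. This fails for one vertex, which is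
-- why the type P(0) is treated apart.
reverse-fixpoint-free : ∀ {A : Set} {k} .{{_ : ℕ.NonZero k}} {p : Vec A (suc k)} → Unique p → reverse p ≢ p
reverse-fixpoint-free {k = suc k} {p} p! eq
  with () ← lookup-injective p! zero (fromℕ (suc k))
              (trans (sym (lookup-reverse-opposite p zero)) (cong (λ q → lookup q (fromℕ (suc k))) eq))

-- Counting paths through their enumerations

module _ {n : ℕ} (𝒯 : Tournament n) where
  open Tournament 𝒯

  samePath-isDecEquivalence : ∀ {k} → IsDecEquivalence (SamePath 𝒯 {k})
  samePath-isDecEquivalence {k} = record { isEquivalence = isEquivalence k ; _≟_ = samePath? 𝒯 }
    where
    isEquivalence : ∀ k → IsEquivalence (SamePath 𝒯 {k})
    isEquivalence ℕ.zero  = record { refl = refl ; sym = sym ; trans = trans }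
    isEquivalence (suc k) = record
      { refl  = λ u v → mk⇔ id id
      ; sym   = λ p~q u v → mk⇔ (Equivalence.from (p~q u v)) (Equivalence.to (p~q u v))
      ; trans = λ p~q q~r u v → mk⇔ (Equivalence.to (q~r u v) ∘ Equivalence.to (p~q u v))
                                    (Equivalence.from (p~q u v) ∘ Equivalence.from (q~r u v))
      }

  samePath-reverse : ∀ {k} (p : Vec (Fin n) (suc k)) → SamePath 𝒯 p (reverse p)
  samePath-reverse {ℕ.zero} (x ∷ []) = refl
  samePath-reverse {suc k}  p u v = mk⇔ (λ (u⟶v , adj) → u⟶v , ⊑-reverse p adj)
                                       (λ (u⟶v , adj) → u⟶v , reverse-⊑ p adj)

  -- Adjacent vertices of `p` are distinct, so the tournament orients the pair in one of the two
  -- ways, and that arc is carried over to `q`.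
  arcs⊆⇒⊑ : ∀ {k} {p q : Vec (Fin n) (suc k)} → Unique p → (∀ u v → Arc 𝒯 p u v → Arc 𝒯 q u v) → p ⊑ q
  arcs⊆⇒⊑ {p = p} {q} p! arcs {u} {v} adj = [ along , against ]′ (⟶-total 𝒯 (distinct adj))
    where
    distinct : Adjacent p u v → u ≢ v
    distinct (i , inj₁ (refl , refl)) = step-distinct 𝒯 p! i
    distinct (i , inj₂ (refl , refl)) = step-distinct 𝒯 p! i ∘ sym

    along : u ⟶ v → Adjacent q u v
    along u⟶v = proj₂ (arcs u v (u⟶v , adj))

    against : v ⟶ u → Adjacent q u v
    against v⟶u = adjacent-sym {p = q} (proj₂ (arcs v u (v⟶u , adjacent-sym {p = p} adj)))

  samePath⇒≡⊎reverse : ∀ {k} .{{_ : ℕ.NonZero k}} {p q : Vec (Fin n) (suc k)} → Unique p → Unique q →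
                       SamePath 𝒯 p q → q ≡ p ⊎ q ≡ reverse p
  samePath⇒≡⊎reverse {suc k} {p} {q} p! q! p~q = sameAdjacency⇒≡⊎reverse p! q!
    (arcs⊆⇒⊑ {p = p} {q} p! λ u v → Equivalence.to (p~q u v))
    (arcs⊆⇒⊑ {p = q} {p} q! λ u v → Equivalence.from (p~q u v))

  module _ {s : ℕ} {c : ℤ} {γ : Vec ℤ s} {β : Bool} (alt : Alternates β (c ∷ γ)) where

    private
      instance
        size-nonZero : ℕ.NonZero (size (c ∷ γ))
        size-nonZero = ℕ.>-nonZero (ℕₚ.<-≤-trans (ℕ.>-nonZero⁻¹ ℤ.∣ c ∣ {{proj₁ alt}}) (ℕₚ.m≤m+n ℤ.∣ c ∣ (size γ)))

      w : Vec Bool (size (c ∷ γ))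
      w = word (c ∷ γ)

    typeAlong⇒dirs : ∀ {p} → Unique p → TypeAlong 𝒯 (c ∷ γ) p → dirs 𝒯 p ≡ w
    typeAlong⇒dirs p! (inj₁ γ≡[0])  = 
      contradiction (cong ℤ.∣_∣ (∷-injectiveˡ γ≡[0])) (ℕ.≢-nonZero⁻¹ ℤ.∣ c ∣ {{proj₁ alt}})
    typeAlong⇒dirs p! (inj₂ blocks) = lookup-extensional λ i → blocks⇒reads 𝒯 p! (c ∷ γ) blocks i i refl

    dirs⇒typeAlong : ∀ {p} → Unique p → dirs 𝒯 p ≡ w → TypeAlong 𝒯 (c ∷ γ) p
    -- No step precedes position `zero`, so the condition on the letter before it is vacuous.
    dirs⇒typeAlong {p} p! eq = inj₂ (reads⇒blocks 𝒯 p! (c ∷ γ) alt refl (λ _ ()) λ i j i≡j →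
      trans (cong (lookup (dirs 𝒯 p)) (toℕ-injective i≡j)) (cong (λ v → lookup v j) eq))

    pathOfType⇒dirs : ∀ {p} → PathOfType 𝒯 (c ∷ γ) p → UpToConverse w (dirs 𝒯 p)
    pathOfType⇒dirs     (p! , inj₁ type) = inj₁ (typeAlong⇒dirs p! type)
    pathOfType⇒dirs {p} (p! , inj₂ type) = inj₂ (trans (sym (converse-involutive (dirs 𝒯 p)))
      (cong converse (trans (sym (dirs-reverse 𝒯 p!)) (typeAlong⇒dirs (reverse-unique p!) type))))

    dirs⇒pathOfType : ∀ {p} → Unique p → UpToConverse w (dirs 𝒯 p) → PathOfType 𝒯 (c ∷ γ) p
    dirs⇒pathOfType p! (inj₁ eq) = p! , inj₁ (dirs⇒typeAlong p! eq)
    dirs⇒pathOfType p! (inj₂ eq) = p! , inj₂ (dirs⇒typeAlong (reverse-unique p!)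
      (trans (dirs-reverse 𝒯 p!) (trans (cong converse eq) (converse-involutive w))))

    pathOfType-reverse : ∀ {p} → PathOfType 𝒯 (c ∷ γ) p → PathOfType 𝒯 (c ∷ γ) (reverse p)
    pathOfType-reverse {p} (p! , inj₁ type) =
      reverse-unique p! , inj₂ (subst (TypeAlong 𝒯 (c ∷ γ)) (sym (reverse-involutive p)) type)
    pathOfType-reverse     (p! , inj₂ type) = reverse-unique p! , inj₁ type

    -- The enumerations of the given type are those reading `w` up to converse. Reversal acts on
    -- them without fixed points, and its orbits are exactly the classes of `SamePath`.
    enumerations≡2f : enumerations 𝒯 w ≡ f 𝒯 (c ∷ γ) ℕ.+ f 𝒯 (c ∷ γ)
    enumerations≡2f = trans
      (bijection⇒length (Uniqueˡ.filter⁺ _ (paths! 𝒯 _)) typed! id id to from (λ _ → refl) (λ _ → refl))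
      (length-deduplicate-pairs samePath-isDecEquivalence reverse typed! reverse-involutive
        (λ p∈ → typed⁺ (pathOfType-reverse (typed⁻ p∈)))
        (λ p∈ → reverse-fixpoint-free (proj₁ (typed⁻ p∈)))
        samePath-reverse
        (λ p∈ q∈ → samePath⇒≡⊎reverse (proj₁ (typed⁻ p∈)) (proj₁ (typed⁻ q∈))))
      where
      typed : List (Vec (Fin n) (suc (size (c ∷ γ))))
      typed = filter (pathOfType? 𝒯 (c ∷ γ)) (allVecs n (suc (size (c ∷ γ))))

      typed! : Uniqueˡ typed
      typed! = Uniqueˡ.filter⁺ _ (allVecs! n _)

      typed⁺ : ∀ {p} → PathOfType 𝒯 (c ∷ γ) p → p ∈ typed
      typed⁺ {p} type = ∈-filter⁺ _ (∈-allVecs p) type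

      typed⁻ : ∀ {p} → p ∈ typed → PathOfType 𝒯 (c ∷ γ) p
      typed⁻ p∈ = proj₂ (∈-filter⁻ (pathOfType? 𝒯 (c ∷ γ)) {xs = allVecs n _} p∈)

      to : ∀ {p} → p ∈ filter (upToConverse? w ∘ dirs 𝒯) (paths 𝒯 _) → p ∈ typed
      to p∈ = let p∈paths , eq = ∈-filter⁻ (upToConverse? w ∘ dirs 𝒯) {xs = paths 𝒯 _} p∈
              in typed⁺ (dirs⇒pathOfType (∈-paths⁻ 𝒯 p∈paths) eq)

      from : ∀ {p} → p ∈ typed → p ∈ filter (upToConverse? w ∘ dirs 𝒯) (paths 𝒯 _)
      from p∈ = ∈-filter⁺ _ (∈-paths⁺ 𝒯 (proj₁ (typed⁻ p∈))) (pathOfType⇒dirs (typed⁻ p∈))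

-- Sign patterns and passage to the negative type

opposite-signs : ∀ c c′ → c * c′ < 0ℤ → ℤ.NonZero c′ × does (0ℤ ℤₚ.<? c′) ≡ not (does (0ℤ ℤₚ.<? c))
opposite-signs (ℤ.+ 0)       c′            cc′<0 = contradiction cc′<0 λ { (ℤ.+<+ ()) }
opposite-signs c             (ℤ.+ 0)       cc′<0 =
  contradiction (subst (_< 0ℤ) (ℤₚ.*-zeroʳ c) cc′<0) λ { (ℤ.+<+ ()) }
opposite-signs ℤ.+[1+ _ ] ℤ.+[1+ _ ] (ℤ.+<+ ())
opposite-signs ℤ.+[1+ _ ] ℤ.-[1+ _ ] _ = _ , refl
opposite-signs ℤ.-[1+ _ ] ℤ.+[1+ _ ] _ = _ , refl
opposite-signs ℤ.-[1+ _ ] ℤ.-[1+ _ ] (ℤ.+<+ ())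

alternates : ∀ {m β} c (γ : Vec ℤ m) → ℤ.NonZero c → does (0ℤ ℤₚ.<? c) ≡ not β →
             ((i : Fin m) → lookup (c ∷ γ) (inject₁ i) * lookup (c ∷ γ) (suc i) < 0ℤ) → Alternates β (c ∷ γ)
alternates c []       c≢0 sign _     = c≢0 , sign , tt
alternates c (c′ ∷ γ) c≢0 sign alt
  with c′≢0 , sign′ ← opposite-signs c c′ (alt zero) =
  c≢0 , sign , alternates c′ γ c′≢0 sign′ (alt ∘ suc)

alternates-negate : ∀ {s β} (γ : Vec ℤ s) → Alternates β γ → Alternates (not β) (negate γ)
alternates-negate []               _                = tt
alternates-negate (ℤ.+[1+ m ] ∷ γ) (_ , sign , alt) = _ , cong not sign , alternates-negate γ alt
alternates-negate (ℤ.-[1+ m ] ∷ γ) (_ , sign , alt) = _ , cong not sign , alternates-negate γ alt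

-- The lengths size (negate γ) and size γ agree only propositionally.
word-negate : ∀ {s β} (γ : Vec ℤ s) → Alternates β γ →
              _≡_ {A = Σ ℕ (Vec Bool)} (size γ , complement (word γ)) (size (negate γ) , word (negate γ))
word-negate []      _ = refl
word-negate (c ∷ γ) (c≢0 , _ , alt) = trans
  (cong (size (c ∷ γ) ,_) (trans (map-++ not (replicate ℤ.∣ c ∣ _) (word γ))
                                 (cong (_++ complement (word γ)) (map-replicate not _ ℤ.∣ c ∣))))
  (trans (cong (prefix ℤ.∣ c ∣ _) (word-negate γ alt)) (head-negate c c≢0))
  where
  prefix : ℕ → Bool → Σ ℕ (Vec Bool) → Σ ℕ (Vec Bool)
  prefix m b (k , v) = m ℕ.+ k , replicate m b ++ v

  head-negate : ∀ c → ℤ.NonZero c →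
                prefix ℤ.∣ c ∣ (not (does (0ℤ ℤₚ.<? c))) (size (negate γ) , word (negate γ)) ≡
                (size (negate (c ∷ γ)) , word (negate (c ∷ γ)))
  head-negate ℤ.+[1+ _ ] _ = refl
  head-negate ℤ.-[1+ _ ] _ = refl

m+m≡n+n⇒m≡n : ∀ {m n} → m ℕ.+ m ≡ n ℕ.+ n → m ≡ n
m+m≡n+n⇒m≡n {m} {n} eq = ℕₚ.*-cancelˡ-≡ m n 2
  (trans (cong (m ℕ.+_) (ℕₚ.+-identityʳ m)) (trans eq (sym (cong (n ℕ.+_) (ℕₚ.+-identityʳ n)))))

f-negate : ∀ {n s β} (T : Tournament n) (γ : Vec ℤ (suc s)) → Alternates β γ → f T γ ≡ f T (negate γ)
f-negate T γ@(_ ∷ _) alt = m+m≡n+n⇒m≡n (begin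
  f T γ ℕ.+ f T γ                        ≡⟨ enumerations≡2f T alt ⟨
  enumerations T (word γ)                ≡⟨ enumerations-complement T (word γ) ⟩
  -- `enumerations` takes values in `ℕ` for every word length, so an equality of dependent pairs
  -- suffices.
  enumerations T (complement (word γ))   ≡⟨ cong (λ (_ , w) → enumerations T w) (word-negate γ alt) ⟩
  enumerations T (word (negate γ))       ≡⟨ enumerations≡2f T (alternates-negate γ alt) ⟩
  f T (negate γ) ℕ.+ f T (negate γ)      ∎)
  where open ≡-Reasoning

theorem4 : (m : ℕ) (α : Vec ℤ (suc m)) →
    ((i : Fin m) → lookup α (inject₁ i) * lookup α (suc i) < 0ℤ) →
    0ℤ ≤ head α →
    (n : ℕ) → n ≡ suc (size α) →
    (T : Tournament n) →
    f T α ≡ f T (negate α)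
-- `negate` fixes the vector with single entry zero by computation.
theorem4 0       (ℤ.+ 0 ∷ [])     _   _ _ _ _ = refl
theorem4 (suc m) (ℤ.+ 0 ∷ _)      alt _ _ _ _ = contradiction (alt zero) λ { (ℤ.+<+ ()) }
-- A positive first entry needs a fictitious negative predecessor, hence `β = false`.
theorem4 m       (ℤ.+[1+ a ] ∷ γ) alt _ _ _ T =
  f-negate T (ℤ.+[1+ a ] ∷ γ) (alternates {β = false} ℤ.+[1+ a ] γ _ refl alt)
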